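{- The proved and best-known small values $f(2)=6$, $f(3)=11$, $f(4)\le 21$, $f(5)\le 41$ all equal $5\cdot 2^{d-2}+1$, suggesting this as a closed form for $f(d)$. It fails from $d=7$: the lifting inequality $f(r+3)\le 6\cdot 2^r+3f(r)$ gives $f(7)\le 6\cdot 2^4+3\cdot 21=159<161=5\cdot 2^5+1$, and asymptotically $f(d)\le 1.2\cdot 2^d$ beats $1.25\cdot 2^d$. The closed form remains the best known value for $d\le 6$.
   Context: Write $[3]=\{0,1,2\}$. A proper sub-box of $[3]^d$ is a set $B=S_1\times\dots\times S_d$ with $\varnothing\neq S_i\subsetneq[3]$ for every $1\le i\le d$ (so each side $S_i$ has one or two elements). A double cover of $[3]^d$ is a finite multiset $\{B_1,\dots,B_m\}$ of proper sub-boxes such that every point of $[3]^d$ lies in exactly two of the $B_j$, counted with multiplicity; its size is $m$. $f(d)$ denotes the minimum size of a double cover of $[3]^d$. The lifting inequality ("leapfrog lift") $f(r+3)\le 6\cdot 2^r+3f(r)$ holds for all $r\ge 0$; iterating it gives $f(d)\le(\tfrac65+o(1))2^d$, which is the precise form of the asymptotic bound in the claim. "Best known" refers to the smallest size of a double cover known at the time of the paper. -}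

module Defs where

open import Data.Bool.Base using (true; false)
open import Data.Fin.Base using (Fin; zero; suc)
open import Data.Fin.Properties as Fin using ()
open import Data.Fin.Subset as Subset using (Subset; Nonempty; _⊂_; ⊤; inside; outside)
open import Data.Fin.Subset.Properties using (_∈?_; _⊂?_; ∈⊤; nonempty?; anySubset?)
open import Data.Integer.Base as ℤ using ()
open import Data.Nat.Base using (ℕ; zero; suc; _+_; _*_; _∸_; _^_; _≤_; z≤n; s≤s)
open import Data.Nat.Properties as Nat using ()
open import Data.Product.Base using (Σ-syntax; ∃; _×_; _,_; proj₁; proj₂)
open import Data.Rational.Base as ℚ using (ℚ)
open import Data.Vec.Base as Vec using (Vec; []; _∷_; _++_; map; count)
open import Data.Vec.Relation.Binary.Pointwise.Inductive as Pointwise using (Pointwise)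
open import Data.Vec.Relation.Unary.All as All using (All; []; _∷_)
open import Data.Vec.Relation.Unary.All.Properties using (++⁺; map⁺)
open import Function.Base using (_∘_)
open import Relation.Binary.PropositionalEquality
  using (_≡_; refl; trans; cong; cong₂)
open import Relation.Nullary.Decidable
  using (Dec; yes; no; does; map′; ¬?; _×-dec_; decidable-stable)
open import Relation.Nullary.Negation using (contradiction)
open import Relation.Unary using (Decidable)

Point : ℕ → Set
Point d = Vec (Fin 3) d

-- The vector of sides S₁, …, S_d stands for the product S₁ × ⋯ × S_d.
Box : ℕ → Set
Box d = Vec (Subset 3) d

ProperSide : Subset 3 → Set
ProperSide S = Nonempty S × S ⊂ ⊤

ProperBox : ∀ {d} → Box d → Set
ProperBox B = All ProperSide B

infix 4 _∈Box_ _∈Box?_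

_∈Box_ : ∀ {d} → Point d → Box d → Set
p ∈Box B = Pointwise Subset._∈_ p B

_∈Box?_ : ∀ {d} (p : Point d) (B : Box d) → Dec (p ∈Box B)
_∈Box?_ = Pointwise.decidable _∈?_

-- A multiset of m boxes is given by listing its elements in some order, with
-- repetition; neither the condition below nor the size depends on the order.
IsDoubleCover : ∀ {d m} → Vec (Box d) m → Set
IsDoubleCover {d} Bs = All ProperBox Bs × (∀ (p : Point d) → count (p ∈Box?_) Bs ≡ 2)

HasDoubleCover : ℕ → ℕ → Set
HasDoubleCover d m = Σ[ Bs ∈ Vec (Box d) m ] IsDoubleCover Bs

IsLeast : (ℕ → Set) → ℕ → Set
IsLeast P m = P m × (∀ n → P n → m ≤ n)

private
  Searchable : Set → Set₁
  Searchable A = ∀ {P : A → Set} → Decidable P → Dec (∃ P)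

  search-Vec : ∀ {A} → Searchable A → ∀ n → Searchable (Vec A n)
  search-Vec s zero    P? = map′ ([] ,_) (λ { ([] , px) → px }) (P? [])
  search-Vec s (suc n) P? =
    map′ (λ { (x , xs , p) → x ∷ xs , p }) (λ { (x ∷ xs , p) → x , xs , p })
         (s λ x → search-Vec s n λ xs → P? (x ∷ xs))

  search-∀ : ∀ {A} → Searchable A → ∀ {P : A → Set} → Decidable P → Dec (∀ x → P x)
  search-∀ s P? =
    map′ (λ ¬∃ x → decidable-stable (P? x) λ ¬px → ¬∃ (x , ¬px))
         (λ ∀p (x , ¬px) → ¬px (∀p x))
         (¬? (s (¬? ∘ P?)))

  isDoubleCover? : ∀ {d m} → Decidable (IsDoubleCover {d} {m})
  isDoubleCover? {d} Bs =
    All.all? (All.all? λ S → nonempty? S ×-dec (S ⊂? ⊤)) Bs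
    ×-dec search-∀ (search-Vec Fin.any? d) (λ p → count (p ∈Box?_) Bs Nat.≟ 2)

hasDoubleCover? : ∀ d → Decidable (HasDoubleCover d)
hasDoubleCover? d m = search-Vec (search-Vec anySubset? d) m isDoubleCover?

private
  least : ∀ {P : ℕ → Set} → Decidable P → ∀ n → P n → ∃ (IsLeast P)
  least P? n pn with P? 0
  ... | yes p0 = 0 , p0 , λ _ _ → z≤n
  least P? zero    pn | no ¬p0 = contradiction pn ¬p0
  least P? (suc n) pn | no ¬p0 with least (P? ∘ suc) n pn
  ... | m , pm , m≤ = suc m , pm , λ where
    zero    p0 → contradiction p0 ¬p0
    (suc k) pk → s≤s (m≤ k pk)

  count-++ : ∀ {d m n} (p : Point d) (Bs : Vec (Box d) m) (Cs : Vec (Box d) n) →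
             count (p ∈Box?_) (Bs ++ Cs) ≡ count (p ∈Box?_) Bs + count (p ∈Box?_) Cs
  count-++ p []       Cs = refl
  count-++ p (B ∷ Bs) Cs with does (p ∈Box? B)
  ... | true  = cong suc (count-++ p Bs Cs)
  ... | false = count-++ p Bs Cs

  count-in : ∀ {d m} x (S : Subset 3) → does (x ∈? S) ≡ true →
             (p : Point d) (Bs : Vec (Box d) m) →
             count ((x ∷ p) ∈Box?_) (map (S ∷_) Bs) ≡ count (p ∈Box?_) Bs
  count-in x S eq p [] = refl
  count-in x S eq p (B ∷ Bs) rewrite eq with does (p ∈Box? B)
  ... | true  = cong suc (count-in x S eq p Bs)
  ... | false = count-in x S eq p Bs

  count-out : ∀ {d m} x (S : Subset 3) → does (x ∈? S) ≡ false →
              (p : Point d) (Bs : Vec (Box d) m) →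
              count ((x ∷ p) ∈Box?_) (map (S ∷_) Bs) ≡ 0
  count-out x S eq p [] = refl
  count-out x S eq p (B ∷ Bs) rewrite eq = count-out x S eq p Bs

-- Splitting every side as {0} ∪ {1,2}, with every box taken twice, gives a
-- double cover, so the minimum defining f is over a nonempty set.
doubleCover-exists : ∀ d → ∃ (HasDoubleCover d)
doubleCover-exists zero = 2 , [] ∷ [] ∷ [] , [] ∷ [] ∷ [] , λ { [] → refl }
doubleCover-exists (suc d) with doubleCover-exists d
... | m , Bs , proper , two =
  m + m , map (S ∷_) Bs ++ map (T ∷_) Bs ,
  ++⁺ (map⁺ (All.map (S-proper ∷_) proper)) (map⁺ (All.map (T-proper ∷_) proper)) ,
  covers
  where
  S T : Subset 3
  S = inside ∷ outside ∷ outside ∷ []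
  T = outside ∷ inside ∷ inside ∷ []

  S-proper : ProperSide S
  S-proper = (zero , Vec.here) , (λ _ → ∈⊤) , suc zero , ∈⊤ , λ { (Vec.there ()) }

  T-proper : ProperSide T
  T-proper = (suc zero , Vec.there Vec.here) , (λ _ → ∈⊤) , zero , ∈⊤ , λ ()

  covers : ∀ p → count (p ∈Box?_) (map (S ∷_) Bs ++ map (T ∷_) Bs) ≡ 2
  covers (x ∷ p) = trans (count-++ (x ∷ p) (map (S ∷_) Bs) (map (T ∷_) Bs)) (go x)
    where
    go : ∀ x → count ((x ∷ p) ∈Box?_) (map (S ∷_) Bs)
             + count ((x ∷ p) ∈Box?_) (map (T ∷_) Bs) ≡ 2
    go zero = cong₂ _+_ (trans (count-in zero S refl p Bs) (two p))
                        (count-out zero T refl p Bs)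
    go (suc zero) = cong₂ _+_ (count-out (suc zero) S refl p Bs)
                              (trans (count-in (suc zero) T refl p Bs) (two p))
    go (suc (suc zero)) = cong₂ _+_ (count-out (suc (suc zero)) S refl p Bs)
                                    (trans (count-in (suc (suc zero)) T refl p Bs) (two p))

-- f is opaque so that type checking never runs the exhaustive search behind
-- it; f-isLeast determines it.
opaque
  f : ℕ → ℕ
  f d = let m , c = doubleCover-exists d in proj₁ (least (hasDoubleCover? d) m c)

  f-isLeast : ∀ d → IsLeast (HasDoubleCover d) (f d)
  f-isLeast d = let m , c = doubleCover-exists d in proj₂ (least (hasDoubleCover? d) m c)

-- 5 · 2^(d-2) + 1; only meaningful for d ≥ 2, because of the truncated
-- subtraction.
closedForm : ℕ → ℕ
closedForm d = 5 * 2 ^ (d ∸ 2) + 1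

fromℕ : ℕ → ℚ
fromℕ n = ℤ.+ n ℚ./ 1

{-# OPTIONS --safe #-}

-- Lower bounds: let m be the size of a double cover. In dimension 2 every line
-- is missed by at least two boxes, so the slices have total size at most
-- 6 (m - 2), while counting points bounds that total from below; together
-- 14 m ≥ 72. In dimension 3 each of the nine slices has at least 6 boxes, and
-- volume ≥ 4 · (total side length) - 16 for every box gives 54 + 16 m ≥ 4 · 54.
--
-- Lifting: the six boxes of points of [3]^3 that differ everywhere from a given
-- permutation cover every nonconstant point exactly twice and no constant point.
-- Multiply each by a partition of [3]^r into 2^r boxes, and each of the three
-- constant points by a double cover of [3]^r.
module Submission where

open import Defs
open import Algebra.Properties.CommutativeSemigroup using (interchange)
open import Data.Bool.Base using (Bool; true; false; if_then_else_; _∧_)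
open import Data.Fin.Base using (Fin; zero; suc)
open import Data.Fin.Properties as Fin using ()
open import Data.Fin.Subset using (Subset; inside; outside; ⊤)
open import Data.Fin.Subset.Properties using (_∈?_; _⊂?_; nonempty?)
open import Data.Integer.Base as ℤ using ()
open import Data.Integer.Properties as ℤ using ()
open import Data.Nat.Base using (ℕ; zero; suc; _+_; _*_; _^_; _≤_; _<_; z≤n; s≤s)
open import Data.Nat.Coprimality using (Coprime)
open import Data.Nat.Properties as ℕ using ()
open import Data.Nat.Tactic.RingSolver using (solve-∀)
open import Data.Product.Base using (Σ-syntax; _×_; _,_; proj₁; proj₂)
open import Data.Rational.Base as ℚ using (ℚ; mkℚ; 0ℚ)
open import Data.Rational.Properties as ℚ using ()
open import Data.Rational.Unnormalised.Base as ℚᵘ using (mkℚᵘ)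
open import Data.Rational.Unnormalised.Properties as ℚᵘ using ()
open import Data.Unit.Base using (tt)
open import Data.Vec.Base
  using (Vec; []; _∷_; _++_; map; count; lookup; insertAt; removeAt; splitAt; concat; allFin; allPairs)
open import Data.Vec.Relation.Unary.All as All using (All; []; _∷_)
open import Data.Vec.Relation.Unary.All.Properties using (++⁺; map⁺)
open import Relation.Binary.PropositionalEquality
  using (_≡_; refl; sym; trans; cong; cong₂; subst; subst₂; module ≡-Reasoning)
open import Relation.Nullary.Decidable
  using (Dec; does; map′; _×-dec_; _→-dec_; toWitness; True)
open import Relation.Nullary.Negation using (contradiction)
open import Relation.Unary using (Decidable)

private
  variable
    A B : Set
    d k m n r : ℕ

-- Finite sums over vectors.

∑ : (A → ℕ) → Vec A m → ℕ
∑ w []       = 0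
∑ w (x ∷ xs) = w x + ∑ w xs

∑-+ : ∀ (v w : A → ℕ) (xs : Vec A m) → ∑ (λ x → v x + w x) xs ≡ ∑ v xs + ∑ w xs
∑-+ v w []       = refl
∑-+ v w (x ∷ xs) = trans (cong (v x + w x +_) (∑-+ v w xs))
  (interchange ℕ.+-commutativeSemigroup (v x) (w x) (∑ v xs) (∑ w xs))

∑-* : ∀ c (w : A → ℕ) (xs : Vec A m) → ∑ (λ x → c * w x) xs ≡ c * ∑ w xs
∑-* c w []       = sym (ℕ.*-zeroʳ c)
∑-* c w (x ∷ xs) = trans (cong (c * w x +_) (∑-* c w xs)) (sym (ℕ.*-distribˡ-+ c (w x) (∑ w xs)))

∑-const : ∀ c (xs : Vec A m) → ∑ (λ _ → c) xs ≡ m * c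
∑-const c []       = refl
∑-const c (x ∷ xs) = cong (c +_) (∑-const c xs)

∑-mono : ∀ {P : A → Set} {v w : A → ℕ} → (∀ {x} → P x → v x ≤ w x) →
         ∀ {xs : Vec A m} → All P xs → ∑ v xs ≤ ∑ w xs
∑-mono v≤w []         = z≤n
∑-mono v≤w (px ∷ pxs) = ℕ.+-mono-≤ (v≤w px) (∑-mono v≤w pxs)

∑-cong : ∀ {v w : A → ℕ} → (∀ x → v x ≡ w x) → (xs : Vec A m) → ∑ v xs ≡ ∑ w xs
∑-cong v≡w []       = refl
∑-cong v≡w (x ∷ xs) = cong₂ _+_ (v≡w x) (∑-cong v≡w xs)

∑-comm : ∀ (w : A → B → ℕ) (xs : Vec A m) (ys : Vec B n) →
         ∑ (λ x → ∑ (w x) ys) xs ≡ ∑ (λ y → ∑ (λ x → w x y) xs) ys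
∑-comm {n = n} w [] ys = sym (trans (∑-const 0 ys) (ℕ.*-zeroʳ n))
∑-comm w (x ∷ xs) ys = trans (cong (∑ (w x) ys +_) (∑-comm w xs ys))
  (sym (∑-+ (w x) (λ y → ∑ (λ x → w x y) xs) ys))

∑-++ : ∀ (w : A → ℕ) (xs : Vec A m) (ys : Vec A n) → ∑ w (xs ++ ys) ≡ ∑ w xs + ∑ w ys
∑-++ w []       ys = refl
∑-++ w (x ∷ xs) ys = trans (cong (w x +_) (∑-++ w xs ys)) (sym (ℕ.+-assoc (w x) _ _))

∑-map : ∀ (w : B → ℕ) (g : A → B) (xs : Vec A m) → ∑ w (map g xs) ≡ ∑ (λ x → w (g x)) xs
∑-map w g []       = refl
∑-map w g (x ∷ xs) = cong (w (g x) +_) (∑-map w g xs)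

-- Membership indicators and k-fold covers.

toℕ : Bool → ℕ
toℕ b = if b then 1 else 0

toℕ-∧ : ∀ a b → toℕ (a ∧ b) ≡ toℕ a * toℕ b
toℕ-∧ true  b = sym (ℕ.+-identityʳ (toℕ b))
toℕ-∧ false b = refl

infix 8 _∈ˢ_ _∈ᵇ_

_∈ˢ_ : Fin 3 → Subset 3 → ℕ
x ∈ˢ S = toℕ (does (x ∈? S))

_∈ᵇ_ : Point d → Box d → ℕ
p ∈ᵇ B = toℕ (does (p ∈Box? B))

∈ᵇ-∷ : ∀ x (p : Point d) S B → (x ∷ p) ∈ᵇ (S ∷ B) ≡ x ∈ˢ S * p ∈ᵇ B
∈ᵇ-∷ x p S B = toℕ-∧ (does (x ∈? S)) (does (p ∈Box? B))

∈ᵇ-++ : ∀ (p : Point d) (q : Point r) (B : Box d) (C : Box r) →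
        (p ++ q) ∈ᵇ (B ++ C) ≡ p ∈ᵇ B * q ∈ᵇ C
∈ᵇ-++ []      q []      C = sym (ℕ.+-identityʳ (q ∈ᵇ C))
∈ᵇ-++ (x ∷ p) q (S ∷ B) C = begin
  (x ∷ p ++ q) ∈ᵇ (S ∷ B ++ C)  ≡⟨ ∈ᵇ-∷ x (p ++ q) S (B ++ C) ⟩
  x ∈ˢ S * (p ++ q) ∈ᵇ (B ++ C) ≡⟨ cong (x ∈ˢ S *_) (∈ᵇ-++ p q B C) ⟩
  x ∈ˢ S * (p ∈ᵇ B * q ∈ᵇ C)    ≡⟨ ℕ.*-assoc (x ∈ˢ S) (p ∈ᵇ B) (q ∈ᵇ C) ⟨
  x ∈ˢ S * p ∈ᵇ B * q ∈ᵇ C      ≡⟨ cong (_* q ∈ᵇ C) (∈ᵇ-∷ x p S B) ⟨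
  (x ∷ p) ∈ᵇ (S ∷ B) * q ∈ᵇ C   ∎
  where open ≡-Reasoning

∈ᵇ-insertAt : ∀ (p : Point d) i x (B : Box (suc d)) →
              insertAt p i x ∈ᵇ B ≡ x ∈ˢ lookup B i * p ∈ᵇ removeAt B i
∈ᵇ-insertAt p       zero    x (S ∷ B)        = ∈ᵇ-∷ x p S B
-- `removeAt` reduces at `suc i` only once the tail is seen to be nonempty.
∈ᵇ-insertAt (y ∷ p) (suc i) x (S ∷ B@(_ ∷ _)) = begin
  (y ∷ insertAt p i x) ∈ᵇ (S ∷ B)                     ≡⟨ ∈ᵇ-∷ y (insertAt p i x) S B ⟩
  y ∈ˢ S * insertAt p i x ∈ᵇ B                        ≡⟨ cong (y ∈ˢ S *_) (∈ᵇ-insertAt p i x B) ⟩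
  y ∈ˢ S * (x ∈ˢ lookup B i * p ∈ᵇ removeAt B i)      ≡⟨ swap (y ∈ˢ S) (x ∈ˢ lookup B i) _ ⟩
  x ∈ˢ lookup B i * (y ∈ˢ S * p ∈ᵇ removeAt B i)      ≡⟨ cong (x ∈ˢ lookup B i *_) (∈ᵇ-∷ y p S _) ⟨
  x ∈ˢ lookup B i * (y ∷ p) ∈ᵇ (S ∷ removeAt B i)     ∎
  where
  open ≡-Reasoning
  swap : ∀ a b c → a * (b * c) ≡ b * (a * c)
  swap = solve-∀

count≡∑ : ∀ (p : Point d) (Bs : Vec (Box d) m) → count (p ∈Box?_) Bs ≡ ∑ (p ∈ᵇ_) Bs
count≡∑ p []       = refl
count≡∑ p (B ∷ Bs) with does (p ∈Box? B)
... | true  = cong suc (count≡∑ p Bs)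
... | false = count≡∑ p Bs

-- Multiplicity 1 gives the partitions used in the lift. Summed indicators replace `count` so that
-- sums can be exchanged and factored.
Cover : (multiplicity dimension size : ℕ) → Set
Cover k d m = Σ[ Bs ∈ Vec (Box d) m ] (All ProperBox Bs × (∀ p → ∑ (p ∈ᵇ_) Bs ≡ k))

Cover⇒HasDoubleCover : Cover 2 d m → HasDoubleCover d m
Cover⇒HasDoubleCover (Bs , proper , covers) =
  Bs , proper , λ p → trans (count≡∑ p Bs) (covers p)

HasDoubleCover⇒Cover : HasDoubleCover d m → Cover 2 d m
HasDoubleCover⇒Cover (Bs , proper , covers) =
  Bs , proper , λ p → trans (sym (count≡∑ p Bs)) (covers p)

f-cover : ∀ d → Cover 2 d (f d)
f-cover d = HasDoubleCover⇒Cover (proj₁ (f-isLeast d))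

f≤ : Cover 2 d m → f d ≤ m
f≤ {d} {m} c = proj₂ (f-isLeast d) m (Cover⇒HasDoubleCover c)

-- Exhaustive checks

allPoints? : ∀ d {P : Point d → Set} → Decidable P → Dec (∀ p → P p)
allPoints? zero    P? = map′ (λ { p [] → p }) (λ p → p []) (P? [])
allPoints? (suc d) P? =
  map′ (λ { h (x ∷ p) → h x p }) (λ h x p → h (x ∷ p))
       (Fin.all? λ x → allPoints? d λ p → P? (x ∷ p))

allSubsets? : ∀ n {P : Subset n → Set} → Decidable P → Dec (∀ S → P S)
allSubsets? zero    P? = map′ (λ { p [] → p }) (λ p → p []) (P? [])
allSubsets? (suc n) P? =
  map′ (λ { (i , o) (true ∷ S) → i S ; (i , o) (false ∷ S) → o S })
       (λ h → (λ S → h (inside ∷ S)) , (λ S → h (outside ∷ S)))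
       (allSubsets? n (λ S → P? (inside ∷ S)) ×-dec allSubsets? n (λ S → P? (outside ∷ S)))

properSide? : Decidable ProperSide
properSide? S = nonempty? S ×-dec (S ⊂? ⊤)

allProperBoxes? : ∀ d {P : Box d → Set} → Decidable P → Dec (∀ B → ProperBox B → P B)
allProperBoxes? zero    P? = map′ (λ { p [] [] → p }) (λ h → h [] []) (P? [])
allProperBoxes? (suc d) P? =
  map′ (λ { h (S ∷ B) (s ∷ b) → h S s B b }) (λ h S s B b → h (S ∷ B) (s ∷ b))
       (allSubsets? 3 λ S → properSide? S →-dec allProperBoxes? d λ B → P? (S ∷ B))

allProper? : Decidable (All (ProperBox {d}) {m})
allProper? = All.all? (All.all? properSide?)

-- For a concrete cover both `True` arguments evaluate to the unit type and are filled in by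
-- computation.
checkCover : ∀ k (Bs : Vec (Box d) m) →
  {True (allProper? Bs)} → {True (allPoints? d λ p → ∑ (p ∈ᵇ_) Bs ℕ.≟ k)} → Cover k d m
checkCover k Bs {proper} {covers} = Bs , toWitness proper , toWitness covers

-- Lower bounds

points : ∀ d → Vec (Point d) (3 ^ d)
points zero    = [] ∷ []
points (suc d) = concat (map (λ x → map (x ∷_) (points d)) (allFin 3))

volume : Box d → ℕ
volume {d} B = ∑ (_∈ᵇ B) (points d)

-- Double counting of incidences; `ps` will be the whole grid or a single line.
∑-hits : ∀ (c : Cover k d m) (ps : Vec (Point d) n) →
         ∑ (λ B → ∑ (_∈ᵇ B) ps) (proj₁ c) ≡ n * k
∑-hits {k = k} (Bs , _ , covers) ps = begin
  ∑ (λ B → ∑ (_∈ᵇ B) ps) Bs ≡⟨ ∑-comm (λ B p → p ∈ᵇ B) Bs ps ⟩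
  ∑ (λ p → ∑ (p ∈ᵇ_) Bs) ps ≡⟨ ∑-cong covers ps ⟩
  ∑ (λ _ → k) ps            ≡⟨ ∑-const k ps ⟩
  _                         ∎
  where open ≡-Reasoning

-- (i , x) is the hyperplane of points with i-th coordinate x.
Slice : ℕ → Set
Slice d = Fin d × Fin 3

slices : ∀ d → Vec (Slice d) (d * 3)
slices d = allPairs (allFin d) (allFin 3)

meets : Slice d → Box d → ℕ
meets (i , x) B = x ∈ˢ lookup B i

-- The boxes meeting the hyperplane, with coordinate `i` dropped, cover a grid of one dimension
-- less. The size is the sum itself, so lower bounds on covers apply to it directly.
restrict : ∀ (s : Slice (suc d)) (c : Cover k (suc d) m) → Cover k d (∑ (meets s) (proj₁ c))
restrict {d} {k} (i , x) (Bs , proper , covers) =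
  let Cs , properC , same = go Bs proper
  in Cs , properC , λ p → trans (same p) (covers (insertAt p i x))
  where
  removeAt⁺ : ∀ {n} {B : Box (suc n)} i → ProperBox B → ProperBox (removeAt B i)
  removeAt⁺ zero    (_ ∷ b)         = b
  removeAt⁺ (suc i) (s ∷ b@(_ ∷ _)) = s ∷ removeAt⁺ i b

  go : ∀ {m} (Bs : Vec (Box (suc d)) m) → All ProperBox Bs →
       Σ[ Cs ∈ Vec (Box d) (∑ (meets (i , x)) Bs) ]
         (All ProperBox Cs × (∀ p → ∑ (p ∈ᵇ_) Cs ≡ ∑ (insertAt p i x ∈ᵇ_) Bs))
  go []       []      = [] , [] , λ _ → refl
  go (B ∷ Bs) (b ∷ bs) with go Bs bs
  -- Abstracting the indicator together with the factorisation lets the required length and the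
  -- equation reduce in each branch.
  ... | Cs , cs , same with does (x ∈? lookup B i) | (λ p → ∈ᵇ-insertAt p i x B)
  ...   | true  | eq = removeAt B i ∷ Cs , removeAt⁺ i b ∷ cs ,
                       λ p → cong₂ _+_ (sym (trans (eq p) (ℕ.+-identityʳ _))) (same p)
  ...   | false | eq = Cs , cs , λ p → trans (same p) (cong (_+ _) (sym (eq p)))

size₀ : Cover 2 0 m → 2 ≤ m
size₀ {m} (Bs , _ , covers) = ℕ.≤-reflexive (begin
  2             ≡⟨ covers [] ⟨
  ∑ ([] ∈ᵇ_) Bs ≡⟨ ∑-cong (λ { [] → refl }) Bs ⟩
  ∑ (λ _ → 1) Bs ≡⟨ ∑-const 1 Bs ⟩
  m * 1         ≡⟨ ℕ.*-identityʳ m ⟩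
  m             ∎)
  where open ≡-Reasoning

size₁ : Cover 2 1 m → 3 ≤ m
size₁ {m} c@(Bs , proper , _) = ℕ.*-cancelʳ-≤ 3 m 2 (begin
  6            ≡⟨ ∑-hits c (points 1) ⟨
  ∑ volume Bs  ≤⟨ ∑-mono (λ {B} → volume≤2 B) proper ⟩
  ∑ (λ _ → 2) Bs ≡⟨ ∑-const 2 Bs ⟩
  m * 2        ∎)
  where
  open ℕ.≤-Reasoning
  volume≤2 : ∀ B → ProperBox B → volume B ≤ 2
  volume≤2 = toWitness {a? = allProperBoxes? 1 λ B → volume B ℕ.≤? 2} tt

linePoints : Slice 2 → Vec (Point 2) 3
linePoints (i , x) = map (λ y → insertAt (y ∷ []) i x) (allFin 3)

-- The weighting only shows that at least 3/2 boxes miss the line; integrality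
-- gives 2.
line-misses : ∀ (s : Slice 2) (c : Cover 2 2 m) → 2 + ∑ (meets s) (proj₁ c) ≤ m
line-misses {m} s c@(Bs , proper , _) = ℕ.*-cancelˡ-< 4 (suc (∑ (meets s) Bs)) m
  (ℕ.+-cancelʳ-< 12 (4 * suc (∑ (meets s) Bs)) (4 * m) (begin-strict
    4 * suc (∑ (meets s) Bs) + 12
      ≡⟨ arith (∑ (meets s) Bs) ⟩
    4 * ∑ (meets s) Bs + 16
      <⟨ ℕ.+-monoʳ-< (4 * ∑ (meets s) Bs) (ℕ.n<1+n 16) ⟩
    4 * ∑ (meets s) Bs + 17
      ≤⟨ ℕ.+-monoʳ-≤ (4 * ∑ (meets s) Bs) (ℕ.n≤1+n 17) ⟩
    4 * ∑ (meets s) Bs + 18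
      ≡⟨ cong₂ _+_ (∑-* 4 (meets s) Bs) (∑-hits c (points 2)) ⟨
    ∑ (λ B → 4 * meets s B) Bs + ∑ volume Bs
      ≡⟨ ∑-+ (λ B → 4 * meets s B) volume Bs ⟨
    ∑ (λ B → 4 * meets s B + volume B) Bs
      ≤⟨ ∑-mono (λ {B} → local s B) proper ⟩
    ∑ (λ B → 4 + 2 * lineHits s B) Bs
      ≡⟨ ∑-+ (λ _ → 4) (λ B → 2 * lineHits s B) Bs ⟩
    ∑ (λ _ → 4) Bs + ∑ (λ B → 2 * lineHits s B) Bs
      ≡⟨ cong₂ _+_ (trans (∑-const 4 Bs) (ℕ.*-comm m 4))
                   (trans (∑-* 2 (lineHits s) Bs) (cong (2 *_) (∑-hits c (linePoints s)))) ⟩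
    4 * m + 12 ∎))
  where
  open ℕ.≤-Reasoning

  arith : ∀ n → 4 * suc n + 12 ≡ 4 * n + 16
  arith = solve-∀

  lineHits : Slice 2 → Box 2 → ℕ
  lineHits s B = ∑ (_∈ᵇ B) (linePoints s)

  -- A box missing the line has volume at most 4. A box meeting it in b points has volume at most
  -- 2b, as its side across the line has at most two elements.
  local : ∀ s B → ProperBox B → 4 * meets s B + volume B ≤ 4 + 2 * lineHits s B
  local (i , x) = toWitness {a? = Fin.all? λ i → Fin.all? λ x → allProperBoxes? 2 λ B →
    4 * meets (i , x) B + volume B ℕ.≤? 4 + 2 * lineHits (i , x) B} tt i x

-- The total side length, written as a number of hyperplanes met so that exchanging sums turns it
-- into the total size of the slices.
sides : Box d → ℕ
sides {d} B = ∑ (λ s → meets s B) (slices d)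

∑-sides : ∀ (Bs : Vec (Box d) m) → ∑ sides Bs ≡ ∑ (λ s → ∑ (meets s) Bs) (slices d)
∑-sides {d} Bs = ∑-comm (λ B s → meets s B) Bs (slices d)

size₂ : Cover 2 2 m → 6 ≤ m
-- 72 ≤ 14 m and 14 · 5 = 70 force m > 5.
size₂ {m} c@(Bs , proper , _) = ℕ.*-cancelˡ-< 14 5 m (ℕ.≤-trans (ℕ.n≤1+n 71) (72≤14m m (∑ sides Bs) lower upper))
  where
  open ℕ.≤-Reasoning

  lower : 36 + 4 * m ≤ 3 * ∑ sides Bs
  lower = begin
    36 + 4 * m                           ≡⟨ cong₂ _+_ (trans (∑-* 2 volume Bs) (cong (2 *_) (∑-hits c (points 2))))
                                                      (trans (∑-const 4 Bs) (ℕ.*-comm m 4)) ⟨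
    ∑ (λ B → 2 * volume B) Bs + ∑ (λ _ → 4) Bs ≡⟨ ∑-+ (λ B → 2 * volume B) (λ _ → 4) Bs ⟨
    ∑ (λ B → 2 * volume B + 4) Bs        ≤⟨ ∑-mono (λ {B} → local B) proper ⟩
    ∑ (λ B → 3 * sides B) Bs             ≡⟨ ∑-* 3 sides Bs ⟩
    3 * ∑ sides Bs                       ∎
    where
    -- For side lengths a, b in {1, 2} this is 2ab + 4 ≤ 3(a + b), with equality when a = b.
    local : ∀ B → ProperBox B → 2 * volume B + 4 ≤ 3 * sides B
    local = toWitness {a? = allProperBoxes? 2 λ B → 2 * volume B + 4 ℕ.≤? 3 * sides B} tt

  upper : 12 + ∑ sides Bs ≤ 6 * m
  upper = begin
    12 + ∑ sides Bs                             ≡⟨ cong₂ _+_ (∑-const 2 (slices 2)) (sym (∑-sides Bs)) ⟨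
    ∑ (λ _ → 2) (slices 2) + ∑ (λ s → ∑ (meets s) Bs) (slices 2) ≡⟨ ∑-+ (λ _ → 2) (λ s → ∑ (meets s) Bs) (slices 2) ⟨
    ∑ (λ s → 2 + ∑ (meets s) Bs) (slices 2)     ≤⟨ ∑-mono (λ {s} _ → line-misses s c) (All.universal (λ _ → tt) (slices 2)) ⟩
    ∑ (λ _ → m) (slices 2)                      ≡⟨ ∑-const m (slices 2) ⟩
    6 * m                                       ∎

  72≤14m : ∀ m n → 36 + 4 * m ≤ 3 * n → 12 + n ≤ 6 * m → 72 ≤ 14 * m
  72≤14m m n lo hi = ℕ.+-cancelʳ-≤ (4 * m) 72 (14 * m) (begin
    72 + 4 * m          ≡⟨⟩
    36 + (36 + 4 * m)   ≤⟨ ℕ.+-monoʳ-≤ 36 lo ⟩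
    36 + 3 * n          ≡⟨ ℕ.*-distribˡ-+ 3 12 n ⟨
    3 * (12 + n)        ≤⟨ ℕ.*-monoʳ-≤ 3 hi ⟩
    3 * (6 * m)         ≡⟨ split m ⟩
    14 * m + 4 * m      ∎)
    where
    split : ∀ m → 3 * (6 * m) ≡ 14 * m + 4 * m
    split = solve-∀

size₃ : Cover 2 3 m → 11 ≤ m
-- 214 = 54 + 16 · 10 lies below 4 · 54 = 216, which excludes ten boxes.
size₃ {m} c@(Bs , proper , _) = ℕ.*-cancelˡ-< 16 10 m (ℕ.+-cancelˡ-< 54 160 (16 * m) (begin-strict
  214                              <⟨ ℕ.n<1+n 214 ⟩
  215                              <⟨ ℕ.n<1+n 215 ⟩
  4 * 54                           ≡⟨ cong (4 *_) (∑-const 6 (slices 3)) ⟨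
  4 * ∑ (λ _ → 6) (slices 3)       ≤⟨ ℕ.*-monoʳ-≤ 4 (∑-mono (λ {s} _ → size₂ (restrict s c)) (All.universal (λ _ → tt) (slices 3))) ⟩
  4 * ∑ (λ s → ∑ (meets s) Bs) (slices 3) ≡⟨ cong (4 *_) (∑-sides Bs) ⟨
  4 * ∑ sides Bs                   ≡⟨ ∑-* 4 sides Bs ⟨
  ∑ (λ B → 4 * sides B) Bs         ≤⟨ ∑-mono (λ {B} → local B) proper ⟩
  ∑ (λ B → volume B + 16) Bs       ≡⟨ ∑-+ volume (λ _ → 16) Bs ⟩
  ∑ volume Bs + ∑ (λ _ → 16) Bs    ≡⟨ cong₂ _+_ (∑-hits c (points 3)) (trans (∑-const 16 Bs) (ℕ.*-comm m 16)) ⟩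
  54 + 16 * m                      ∎))
  where
  open ℕ.≤-Reasoning
  -- Equality holds exactly when at least two of the three sides have two elements.
  local : ∀ B → ProperBox B → 4 * sides B ≤ volume B + 16
  local = toWitness {a? = allProperBoxes? 3 λ B → 4 * sides B ℕ.≤? volume B + 16} tt

-- Constructions

_⊎ᶜ_ : ∀ {j k} → Cover j d m → Cover k d n → Cover (j + k) d (m + n)
(Bs , bs , j-fold) ⊎ᶜ (Cs , cs , k-fold) =
  Bs ++ Cs , ++⁺ bs cs , λ p → trans (∑-++ (p ∈ᵇ_) Bs Cs) (cong₂ _+_ (j-fold p) (k-fold p))

infixl 7 _⊗_

-- Recursion on the second factor makes the size `n * m`, which for the six cubes is literally the
-- `6 * 2 ^ r` of the lift.
_⊗_ : Vec (Box d) m → Vec (Box r) n → Vec (Box (d + r)) (n * m)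
Bs ⊗ []       = []
Bs ⊗ (C ∷ Cs) = map (_++ C) Bs ++ Bs ⊗ Cs

⊗-proper : ∀ {Bs : Vec (Box d) m} {Cs : Vec (Box r) n} →
           All ProperBox Bs → All ProperBox Cs → All ProperBox (Bs ⊗ Cs)
⊗-proper bs []       = []
⊗-proper bs (c ∷ cs) = ++⁺ (map⁺ (All.map (λ b → ++⁺ b c) bs)) (⊗-proper bs cs)

-- Indicators of product boxes factor, so multiplicities multiply.
∑-⊗ : ∀ (p : Point d) (q : Point r) (Bs : Vec (Box d) m) (Cs : Vec (Box r) n) →
      ∑ ((p ++ q) ∈ᵇ_) (Bs ⊗ Cs) ≡ ∑ (p ∈ᵇ_) Bs * ∑ (q ∈ᵇ_) Cs
∑-⊗ p q Bs []       = sym (ℕ.*-zeroʳ (∑ (p ∈ᵇ_) Bs))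
∑-⊗ p q Bs (C ∷ Cs) = begin
  ∑ ((p ++ q) ∈ᵇ_) (map (_++ C) Bs ++ Bs ⊗ Cs)
    ≡⟨ ∑-++ ((p ++ q) ∈ᵇ_) (map (_++ C) Bs) (Bs ⊗ Cs) ⟩
  ∑ ((p ++ q) ∈ᵇ_) (map (_++ C) Bs) + ∑ ((p ++ q) ∈ᵇ_) (Bs ⊗ Cs)
    ≡⟨ cong₂ _+_ single (∑-⊗ p q Bs Cs) ⟩
  ∑ (p ∈ᵇ_) Bs * q ∈ᵇ C + ∑ (p ∈ᵇ_) Bs * ∑ (q ∈ᵇ_) Cs
    ≡⟨ ℕ.*-distribˡ-+ (∑ (p ∈ᵇ_) Bs) (q ∈ᵇ C) (∑ (q ∈ᵇ_) Cs) ⟨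
  ∑ (p ∈ᵇ_) Bs * ∑ (q ∈ᵇ_) (C ∷ Cs) ∎
  where
  open ≡-Reasoning
  single : ∑ ((p ++ q) ∈ᵇ_) (map (_++ C) Bs) ≡ ∑ (p ∈ᵇ_) Bs * q ∈ᵇ C
  single = begin
    ∑ ((p ++ q) ∈ᵇ_) (map (_++ C) Bs)   ≡⟨ ∑-map ((p ++ q) ∈ᵇ_) (_++ C) Bs ⟩
    ∑ (λ B → (p ++ q) ∈ᵇ (B ++ C)) Bs   ≡⟨ ∑-cong (λ B → trans (∈ᵇ-++ p q B C) (ℕ.*-comm (p ∈ᵇ B) (q ∈ᵇ C))) Bs ⟩
    ∑ (λ B → q ∈ᵇ C * p ∈ᵇ B) Bs        ≡⟨ ∑-* (q ∈ᵇ C) (p ∈ᵇ_) Bs ⟩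
    q ∈ᵇ C * ∑ (p ∈ᵇ_) Bs               ≡⟨ ℕ.*-comm (q ∈ᵇ C) _ ⟩
    ∑ (p ∈ᵇ_) Bs * q ∈ᵇ C               ∎

s₀ s₁ s₂ s₀₁ s₀₂ s₁₂ : Subset 3
s₀  = inside  ∷ outside ∷ outside ∷ []
s₁  = outside ∷ inside  ∷ outside ∷ []
s₂  = outside ∷ outside ∷ inside  ∷ []
s₀₁ = inside  ∷ inside  ∷ outside ∷ []
s₀₂ = inside  ∷ outside ∷ inside  ∷ []
s₁₂ = outside ∷ inside  ∷ inside  ∷ []

partition : ∀ d → Cover 1 d (2 ^ d)
partition zero    = checkCover 1 ([] ∷ [])
partition (suc d) = subst (Cover 1 (suc d)) (ℕ.*-comm (2 ^ d) 2) (halves , proper , covers)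
  where
  ends = checkCover 1 ((s₀ ∷ []) ∷ (s₁₂ ∷ []) ∷ [])
  halves = proj₁ ends ⊗ proj₁ (partition d)
  proper = ⊗-proper (proj₁ (proj₂ ends)) (proj₁ (proj₂ (partition d)))
  covers : ∀ p → ∑ (p ∈ᵇ_) halves ≡ 1
  covers (x ∷ p) = trans (∑-⊗ (x ∷ []) p (proj₁ ends) (proj₁ (partition d)))
    (cong₂ _*_ (proj₂ (proj₂ ends) (x ∷ [])) (proj₂ (proj₂ (partition d)) p))

-- The sides of the box of a permutation π are the complements of its values. A point q lies in it
-- when π differs from q in every place. If q is a permutation, two such π exist, the derangements
-- relative to q. If q has the value a exactly twice, π must put a in the third place and may order
-- the other two values freely: again two. If q is constant, its value has no place left in π.
permutationCubes : Vec (Box 3) 6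
permutationCubes =
  (s₁₂ ∷ s₀₂ ∷ s₀₁ ∷ []) ∷ (s₁₂ ∷ s₀₁ ∷ s₀₂ ∷ []) ∷ (s₀₂ ∷ s₁₂ ∷ s₀₁ ∷ []) ∷
  (s₀₂ ∷ s₀₁ ∷ s₁₂ ∷ []) ∷ (s₀₁ ∷ s₁₂ ∷ s₀₂ ∷ []) ∷ (s₀₁ ∷ s₀₂ ∷ s₁₂ ∷ []) ∷ []

diagonal : Vec (Box 3) 3
diagonal = (s₀ ∷ s₀ ∷ s₀ ∷ []) ∷ (s₁ ∷ s₁ ∷ s₁ ∷ []) ∷ (s₂ ∷ s₂ ∷ s₂ ∷ []) ∷ []

leapfrog : Cover 2 r n → Cover 2 (r + 3) (6 * 2 ^ r + 3 * n)
leapfrog {r} (Bs , bs , double) =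
  Ps ⊗ permutationCubes ++ Bs ⊗ diagonal ,
  ++⁺ (⊗-proper ps (toWitness {a? = allProper? permutationCubes} tt))
      (⊗-proper bs (toWitness {a? = allProper? diagonal} tt)) ,
  covers
  where
  Ps = proj₁ (partition r)
  ps = proj₁ (proj₂ (partition r))
  single = proj₂ (proj₂ (partition r))

  -- The factors 1 and 2 are the multiplicities of the partition and of the double cover of the
  -- first `r` coordinates.
  template : ∀ q → 1 * ∑ (q ∈ᵇ_) permutationCubes + 2 * ∑ (q ∈ᵇ_) diagonal ≡ 2
  template = toWitness {a? = allPoints? 3 λ q →
    1 * ∑ (q ∈ᵇ_) permutationCubes + 2 * ∑ (q ∈ᵇ_) diagonal ℕ.≟ 2} tt

  covers : ∀ p → ∑ (p ∈ᵇ_) (Ps ⊗ permutationCubes ++ Bs ⊗ diagonal) ≡ 2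
  covers pq with splitAt r pq
  ... | p , q , refl = begin
    ∑ ((p ++ q) ∈ᵇ_) (Ps ⊗ permutationCubes ++ Bs ⊗ diagonal)
      ≡⟨ ∑-++ ((p ++ q) ∈ᵇ_) (Ps ⊗ permutationCubes) (Bs ⊗ diagonal) ⟩
    ∑ ((p ++ q) ∈ᵇ_) (Ps ⊗ permutationCubes) + ∑ ((p ++ q) ∈ᵇ_) (Bs ⊗ diagonal)
      ≡⟨ cong₂ _+_ (trans (∑-⊗ p q Ps permutationCubes) (cong (_* ∑ (q ∈ᵇ_) permutationCubes) (single p)))
                   (trans (∑-⊗ p q Bs diagonal) (cong (_* ∑ (q ∈ᵇ_) diagonal) (double p))) ⟩
    1 * ∑ (q ∈ᵇ_) permutationCubes + 2 * ∑ (q ∈ᵇ_) diagonal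
      ≡⟨ template q ⟩
    2 ∎
    where open ≡-Reasoning

-- Explicit small covers and upper bounds on `f`.

cover₁ : Cover 2 1 3
cover₁ = checkCover 2 ((s₀₁ ∷ []) ∷ (s₀₂ ∷ []) ∷ (s₁₂ ∷ []) ∷ [])

cover₂ : Cover 2 2 6
cover₂ = checkCover 2
  ((s₀₁ ∷ s₀ ∷ []) ∷ (s₀₂ ∷ s₁ ∷ []) ∷ (s₁₂ ∷ s₀₁ ∷ []) ∷
   (s₁₂ ∷ s₂ ∷ []) ∷ (s₀₂ ∷ s₀₂ ∷ []) ∷ (s₀₁ ∷ s₁₂ ∷ []) ∷ [])

cover₃ : Cover 2 3 11
cover₃ = checkCover 2
  ((s₁₂ ∷ s₀₂ ∷ s₀  ∷ []) ∷ (s₁₂ ∷ s₁₂ ∷ s₀  ∷ []) ∷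
   (s₀₁ ∷ s₀₁ ∷ s₁  ∷ []) ∷ (s₀₂ ∷ s₀₁ ∷ s₁  ∷ []) ∷
   (s₀  ∷ s₂  ∷ s₀₁ ∷ []) ∷ (s₀₁ ∷ s₀₁ ∷ s₀₂ ∷ []) ∷
   (s₀₂ ∷ s₀₁ ∷ s₀₂ ∷ []) ∷ (s₀  ∷ s₂  ∷ s₀₂ ∷ []) ∷
   (s₀  ∷ s₂  ∷ s₁₂ ∷ []) ∷ (s₁₂ ∷ s₀₂ ∷ s₁₂ ∷ []) ∷
   (s₁₂ ∷ s₁₂ ∷ s₁₂ ∷ []) ∷ [])

leapfrog-f : ∀ r → f (r + 3) ≤ 6 * 2 ^ r + 3 * f r
leapfrog-f r = f≤ (leapfrog (f-cover r))

-- Two copies of one partition: a crude bound that starts the induction in `f-excess`.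
f-2^ : ∀ d → f d ≤ 2 ^ d + 2 ^ d
f-2^ d = f≤ (partition d ⊎ᶜ partition d)

-- Found by computer search.
cover₅ : Cover 2 5 41
cover₅ = checkCover 2
  ((s₀  ∷ s₀₂ ∷ s₀₂ ∷ s₀₂ ∷ s₁₂ ∷ []) ∷
   (s₀  ∷ s₁₂ ∷ s₀₁ ∷ s₁  ∷ s₀₂ ∷ []) ∷
   (s₀  ∷ s₁₂ ∷ s₀₂ ∷ s₁  ∷ s₀₁ ∷ []) ∷
   (s₁  ∷ s₀₁ ∷ s₀₁ ∷ s₁  ∷ s₁₂ ∷ []) ∷
   (s₁  ∷ s₀₂ ∷ s₀₂ ∷ s₁  ∷ s₁₂ ∷ []) ∷
   (s₁  ∷ s₁₂ ∷ s₀₁ ∷ s₀₂ ∷ s₀₂ ∷ []) ∷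
   (s₀₁ ∷ s₀  ∷ s₀  ∷ s₀₂ ∷ s₀  ∷ []) ∷
   (s₀₁ ∷ s₀  ∷ s₀  ∷ s₁₂ ∷ s₀  ∷ []) ∷
   (s₀₁ ∷ s₁  ∷ s₂  ∷ s₀₂ ∷ s₂  ∷ []) ∷
   (s₀₁ ∷ s₁  ∷ s₂  ∷ s₁₂ ∷ s₂  ∷ []) ∷
   (s₀₁ ∷ s₀₁ ∷ s₀₁ ∷ s₀₂ ∷ s₁₂ ∷ []) ∷
   (s₀₁ ∷ s₀₁ ∷ s₁₂ ∷ s₀  ∷ s₀₁ ∷ []) ∷
   (s₀₁ ∷ s₀₁ ∷ s₁₂ ∷ s₁₂ ∷ s₀₁ ∷ []) ∷
   (s₀₁ ∷ s₂  ∷ s₁  ∷ s₀₂ ∷ s₁  ∷ []) ∷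
   (s₀₁ ∷ s₂  ∷ s₁  ∷ s₁₂ ∷ s₁  ∷ []) ∷
   (s₀₁ ∷ s₀₂ ∷ s₁₂ ∷ s₀₁ ∷ s₀₂ ∷ []) ∷
   (s₀₁ ∷ s₀₂ ∷ s₁₂ ∷ s₂  ∷ s₀₂ ∷ []) ∷
   (s₀₁ ∷ s₁₂ ∷ s₀₂ ∷ s₀₂ ∷ s₀₁ ∷ []) ∷
   (s₂  ∷ s₀  ∷ s₀₁ ∷ s₂  ∷ s₀  ∷ []) ∷
   (s₂  ∷ s₀  ∷ s₀₂ ∷ s₂  ∷ s₀  ∷ []) ∷
   (s₂  ∷ s₀  ∷ s₁₂ ∷ s₂  ∷ s₀  ∷ []) ∷
   (s₂  ∷ s₀₁ ∷ s₀₁ ∷ s₀₂ ∷ s₁₂ ∷ []) ∷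
   (s₂  ∷ s₀₁ ∷ s₂  ∷ s₂  ∷ s₁₂ ∷ []) ∷
   (s₂  ∷ s₀₁ ∷ s₁₂ ∷ s₀₁ ∷ s₀₁ ∷ []) ∷
   (s₂  ∷ s₀₂ ∷ s₁  ∷ s₂  ∷ s₁₂ ∷ []) ∷
   (s₂  ∷ s₀₂ ∷ s₁₂ ∷ s₀₁ ∷ s₀₂ ∷ []) ∷
   (s₂  ∷ s₁₂ ∷ s₁  ∷ s₂  ∷ s₀₁ ∷ []) ∷
   (s₂  ∷ s₁₂ ∷ s₂  ∷ s₂  ∷ s₀₂ ∷ []) ∷
   (s₂  ∷ s₁₂ ∷ s₀₂ ∷ s₀₂ ∷ s₀₁ ∷ []) ∷
   (s₀₂ ∷ s₀  ∷ s₀  ∷ s₀₁ ∷ s₀  ∷ []) ∷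
   (s₀₂ ∷ s₁  ∷ s₂  ∷ s₀₁ ∷ s₂  ∷ []) ∷
   (s₀₂ ∷ s₀₁ ∷ s₀₁ ∷ s₁  ∷ s₁₂ ∷ []) ∷
   (s₀₂ ∷ s₂  ∷ s₁  ∷ s₀₁ ∷ s₁  ∷ []) ∷
   (s₀₂ ∷ s₀₂ ∷ s₀₂ ∷ s₁  ∷ s₁₂ ∷ []) ∷
   (s₀₂ ∷ s₁₂ ∷ s₀₁ ∷ s₀₂ ∷ s₀₂ ∷ []) ∷
   (s₁₂ ∷ s₀  ∷ s₀  ∷ s₀₁ ∷ s₀  ∷ []) ∷
   (s₁₂ ∷ s₁  ∷ s₂  ∷ s₀₁ ∷ s₂  ∷ []) ∷
   (s₁₂ ∷ s₂  ∷ s₁  ∷ s₀₁ ∷ s₁  ∷ []) ∷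
   (s₁₂ ∷ s₀₂ ∷ s₀₂ ∷ s₀₂ ∷ s₁₂ ∷ []) ∷
   (s₁₂ ∷ s₁₂ ∷ s₀₁ ∷ s₁  ∷ s₀₂ ∷ []) ∷
   (s₁₂ ∷ s₁₂ ∷ s₀₂ ∷ s₁  ∷ s₀₁ ∷ []) ∷ [])

-- Asymptotics

f-step : ∀ d → f (3 + d) ≤ 6 * 2 ^ d + 3 * f d
f-step d = subst (λ n → f n ≤ 6 * 2 ^ d + 3 * f d) (ℕ.+-comm d 3) (leapfrog-f d)

f₄≤21 : f 4 ≤ 21
f₄≤21 = f≤ (leapfrog cover₁)

-- The lift of `cover₂` has 24 + 18 = 42 boxes, one too many, hence the explicit cover.
f₅≤41 : f 5 ≤ 41
f₅≤41 = f≤ cover₅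

f₆≤81 : f 6 ≤ 81
f₆≤81 = f≤ (leapfrog cover₃)

-- One less than the closed form, by induction in steps of 3. The lift gives 159, 315, 627 against
-- 160, 320, 640 at d = 7, 8, 9. Afterwards, with t = 2^(5+n), it gives 24t + 15t = 39t against 40t.
f-from-7 : ∀ n → f (7 + n) ≤ 5 * 2 ^ (5 + n)
f-from-7 0 = ℕ.≤-trans (f-step 4) (ℕ.≤-trans (ℕ.+-monoʳ-≤ 96 (ℕ.*-monoʳ-≤ 3 f₄≤21)) (ℕ.m≤m+n 159 1))
f-from-7 1 = ℕ.≤-trans (f-step 5) (ℕ.≤-trans (ℕ.+-monoʳ-≤ 192 (ℕ.*-monoʳ-≤ 3 f₅≤41)) (ℕ.m≤m+n 315 5))
f-from-7 2 = ℕ.≤-trans (f-step 6) (ℕ.≤-trans (ℕ.+-monoʳ-≤ 384 (ℕ.*-monoʳ-≤ 3 f₆≤81)) (ℕ.m≤m+n 627 13))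
f-from-7 (suc (suc (suc n))) = begin
  f (3 + (7 + n))                     ≤⟨ f-step (7 + n) ⟩
  6 * 2 ^ (7 + n) + 3 * f (7 + n)     ≤⟨ ℕ.+-monoʳ-≤ (6 * 2 ^ (7 + n)) (ℕ.*-monoʳ-≤ 3 (f-from-7 n)) ⟩
  6 * 2 ^ (7 + n) + 3 * (5 * t)       ≤⟨ ℕ.m≤m+n _ t ⟩
  6 * (2 * (2 * t)) + 3 * (5 * t) + t ≡⟨ arith t ⟩
  5 * (2 * (2 * (2 * t)))             ∎
  where
  open ℕ.≤-Reasoning
  t = 2 ^ (5 + n)
  arith : ∀ t → 6 * (2 * (2 * t)) + 3 * (5 * t) + t ≡ 5 * (2 * (2 * (2 * t)))
  arith = solve-∀

-- The excess of f d over 6/5 · 2^d, relative to 2^d, shrinks by the factor 3/8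
-- when d grows by 3; halving is all that is needed.
f-excess : ∀ k d → 2 ^ k * (5 * f (k * 3 + d)) ≤ (6 * 2 ^ k + 6) * 2 ^ (k * 3 + d)
f-excess zero d = begin
  1 * (5 * f d)             ≤⟨ ℕ.*-monoʳ-≤ 1 (ℕ.*-monoʳ-≤ 5 (f-2^ d)) ⟩
  1 * (5 * (2 ^ d + 2 ^ d)) ≤⟨ ℕ.m≤m+n _ (2 * 2 ^ d) ⟩
  1 * (5 * (2 ^ d + 2 ^ d)) + 2 * 2 ^ d ≡⟨ arith (2 ^ d) ⟩
  12 * 2 ^ d                ∎
  where
  open ℕ.≤-Reasoning
  arith : ∀ t → 1 * (5 * (t + t)) + 2 * t ≡ 12 * t
  arith = solve-∀
f-excess (suc k) d = begin
  2 * p * (5 * f (3 + D))                         ≤⟨ ℕ.*-monoʳ-≤ (2 * p) (ℕ.*-monoʳ-≤ 5 (f-step D)) ⟩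
  2 * p * (5 * (6 * t + 3 * f D))                 ≡⟨ expand p t (f D) ⟩
  60 * (p * t) + 6 * (p * (5 * f D))              ≤⟨ ℕ.+-monoʳ-≤ (60 * (p * t)) (ℕ.*-monoʳ-≤ 6 (f-excess k d)) ⟩
  -- The lift leaves an excess of 36t where halving permits 48t.
  60 * (p * t) + 6 * ((6 * p + 6) * t)            ≤⟨ ℕ.m≤m+n _ (12 * t) ⟩
  60 * (p * t) + 6 * ((6 * p + 6) * t) + 12 * t   ≡⟨ collect p t ⟩
  (6 * (2 * p) + 6) * (2 * (2 * (2 * t)))         ∎
  where
  open ℕ.≤-Reasoning
  D = k * 3 + d
  p = 2 ^ k
  t = 2 ^ D
  expand : ∀ p t g → 2 * p * (5 * (6 * t + 3 * g)) ≡ 60 * (p * t) + 6 * (p * (5 * g))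
  expand = solve-∀
  collect : ∀ p t → 60 * (p * t) + 6 * ((6 * p + 6) * t) + 12 * t ≡
                    (6 * (2 * p) + 6) * (2 * (2 * (2 * t)))
  collect = solve-∀

n≤2^n : ∀ n → n ≤ 2 ^ n
n≤2^n zero    = z≤n
n≤2^n (suc n) = begin
  1 + n         ≤⟨ ℕ.+-mono-≤ (ℕ.m^n>0 2 n) (n≤2^n n) ⟩
  2 ^ n + 2 ^ n ≡⟨ cong (2 ^ n +_) (ℕ.+-identityʳ (2 ^ n)) ⟨
  2 * 2 ^ n     ∎
  where open ℕ.≤-Reasoning

-- With ε = a / b, the excess 6 / (5 · 2^k) is at most 3 / (5b), hence at most ε; denominators are
-- cleared throughout.
excess-≤ : ∀ g t k a b → 2 ^ k * (5 * g) ≤ (6 * 2 ^ k + 6) * t → 1 ≤ a → 2 * b ≤ 2 ^ k →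
           g * (5 * b) ≤ (6 * b + a * 5) * t
excess-≤ g t k a b excess 1≤a 2b≤p = ℕ.*-cancelˡ-≤ p {{ℕ.m^n≢0 2 k}} (begin
  p * (g * (5 * b))                 ≡⟨ eq₁ p g b ⟩
  b * (p * (5 * g))                 ≤⟨ ℕ.*-monoʳ-≤ b excess ⟩
  b * ((6 * p + 6) * t)             ≡⟨ eq₂ p t b ⟩
  (6 * b * p + 3 * (2 * b) * 1) * t ≤⟨ ℕ.*-monoˡ-≤ t (ℕ.+-monoʳ-≤ (6 * b * p)
                                         (ℕ.*-mono-≤ (ℕ.*-mono-≤ (ℕ.m≤m+n 3 2) 2b≤p) 1≤a)) ⟩
  (6 * b * p + 5 * p * a) * t       ≡⟨ eq₃ p t a b ⟩
  p * ((6 * b + a * 5) * t)         ∎)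
  where
  open ℕ.≤-Reasoning
  p = 2 ^ k
  eq₁ : ∀ p g b → p * (g * (5 * b)) ≡ b * (p * (5 * g))
  eq₁ = solve-∀
  eq₂ : ∀ p t b → b * ((6 * p + 6) * t) ≡ (6 * b * p + 3 * (2 * b) * 1) * t
  eq₂ = solve-∀
  eq₃ : ∀ p t a b → (6 * b * p + 5 * p * a) * t ≡ p * ((6 * b + a * 5) * t)
  eq₃ = solve-∀

-- Not opened earlier, as it makes sections such as (w x +_) ambiguous.
open import Data.Integer.Base using (+_)

-- Transfer of inequalities from ℕ to ℚ.

toℚᵘ-fromℕ : ∀ n → ℚ.toℚᵘ (fromℕ n) ℚᵘ.≃ mkℚᵘ (+ n) 0
toℚᵘ-fromℕ n = ℚ.toℚᵘ-fromℚᵘ (mkℚᵘ (+ n) 0)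

-- Unnormalised rationals are not reduced by a gcd, so there the comparison is the cross-multiplied
-- hypothesis, up to the embedding into the integers.
fromℕ-≤ : ∀ g t a b .{c : Coprime a (suc b)} → g * (5 * suc b) ≤ (6 * suc b + a * 5) * t →
          fromℕ g ℚ.≤ (+ 6 ℚ./ 5 ℚ.+ mkℚ (+ a) b c) ℚ.* fromℕ t
fromℕ-≤ g t a b {c} h = ℚ.toℚᵘ-cancel-≤ (begin
  ℚ.toℚᵘ (fromℕ g)                                 ≃⟨ toℚᵘ-fromℕ g ⟩
  mkℚᵘ (+ g) 0                                     ≤⟨ ℚᵘ.*≤* (subst₂ ℤ._≤_ lhs rhs (ℤ.+≤+ h)) ⟩
  (mkℚᵘ (+ 6) 4 ℚᵘ.+ mkℚᵘ (+ a) b) ℚᵘ.* mkℚᵘ (+ t) 0 ≃⟨ ℚᵘ.*-cong (ℚ.toℚᵘ-homo-+ (+ 6 ℚ./ 5) (mkℚ (+ a) b c)) (toℚᵘ-fromℕ t) ⟨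
  ℚ.toℚᵘ (+ 6 ℚ./ 5 ℚ.+ mkℚ (+ a) b c) ℚᵘ.* ℚ.toℚᵘ (fromℕ t) ≃⟨ ℚ.toℚᵘ-homo-* (+ 6 ℚ./ 5 ℚ.+ mkℚ (+ a) b c) (fromℕ t) ⟨
  ℚ.toℚᵘ ((+ 6 ℚ./ 5 ℚ.+ mkℚ (+ a) b c) ℚ.* fromℕ t) ∎)
  where
  open ℚᵘ.≤-Reasoning
  lhs : + (g * (5 * suc b)) ≡ + g ℤ.* ℚᵘ.↧ ((mkℚᵘ (+ 6) 4 ℚᵘ.+ mkℚᵘ (+ a) b) ℚᵘ.* mkℚᵘ (+ t) 0)
  lhs = trans (cong (λ z → + (g * z)) (sym (ℕ.*-identityʳ (5 * suc b)))) (ℤ.pos-* g _)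
  rhs : + ((6 * suc b + a * 5) * t) ≡ (((+ 6 ℤ.* + suc b) ℤ.+ (+ a ℤ.* + 5)) ℤ.* + t) ℤ.* + 1
  rhs = trans (ℤ.pos-* (6 * suc b + a * 5) t) (trans
    (cong (ℤ._* + t) (cong₂ ℤ._+_ (ℤ.pos-* 6 (suc b)) (ℤ.pos-* a 5)))
    (sym (ℤ.*-identityʳ _)))

fromℕ-< : ∀ g t → g * 4 < 5 * t → fromℕ g ℚ.< + 5 ℚ./ 4 ℚ.* fromℕ t
fromℕ-< g t h = ℚ.toℚᵘ-cancel-< (begin-strict
  ℚ.toℚᵘ (fromℕ g)                        ≃⟨ toℚᵘ-fromℕ g ⟩
  mkℚᵘ (+ g) 0                            <⟨ ℚᵘ.*<* (subst₂ ℤ._<_ (ℤ.pos-* g 4)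
                                               (trans (ℤ.pos-* 5 t) (sym (ℤ.*-identityʳ _))) (ℤ.+<+ h)) ⟩
  mkℚᵘ (+ 5) 3 ℚᵘ.* mkℚᵘ (+ t) 0          ≃⟨ ℚᵘ.*-congˡ {mkℚᵘ (+ 5) 3} (toℚᵘ-fromℕ t) ⟨
  mkℚᵘ (+ 5) 3 ℚᵘ.* ℚ.toℚᵘ (fromℕ t)      ≃⟨ ℚ.toℚᵘ-homo-* (+ 5 ℚ./ 4) (fromℕ t) ⟨
  ℚ.toℚᵘ (+ 5 ℚ./ 4 ℚ.* fromℕ t)          ∎)
  where open ℚᵘ.≤-Reasoning

f-≤-6/5+ε : ∀ (ε : ℚ) → 0ℚ ℚ.< ε → Σ[ N ∈ ℕ ] (∀ (d : ℕ) → N ≤ d →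
            fromℕ (f d) ℚ.≤ (+ 6 ℚ./ 5 ℚ.+ ε) ℚ.* fromℕ (2 ^ d))
f-≤-6/5+ε (mkℚ (+ zero)  b _) (ℚ.*<* (ℤ.+<+ ()))
f-≤-6/5+ε (mkℚ (ℤ.-[1+ _ ]) b _) (ℚ.*<* ())
f-≤-6/5+ε (mkℚ (+ suc a) b c) _ = K * 3 , λ d N≤d → bound d (ℕ.m≤n⇒∃[o]m+o≡n N≤d)
  where
  -- `suc b` is the denominator of ε. As K ≤ 2^K, K lifts make the excess small enough, and each
  -- lift costs three dimensions.
  K = 2 * suc b
  bound : ∀ d → Σ[ e ∈ ℕ ] K * 3 + e ≡ d → fromℕ (f d) ℚ.≤ (+ 6 ℚ./ 5 ℚ.+ mkℚ (+ suc a) b c) ℚ.* fromℕ (2 ^ d)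
  bound d (e , refl) = fromℕ-≤ (f d) (2 ^ d) (suc a) b {c}
    (excess-≤ (f d) (2 ^ d) K (suc a) (suc b) (f-excess K e) (s≤s z≤n) (n≤2^n K))

f-<-5/4 : Σ[ N ∈ ℕ ] (∀ (d : ℕ) → N ≤ d → fromℕ (f d) ℚ.< + 5 ℚ./ 4 ℚ.* fromℕ (2 ^ d))
-- `f-from-7` gives only the non-strict bound. Five lifts (15 = 5 · 3) bound 5 f(d) / 2^d by 6 +
-- 6/32 = 198/32, below 25/4 = 200/32.
f-<-5/4 = 15 , λ d 15≤d → bound d (ℕ.m≤n⇒∃[o]m+o≡n 15≤d)
  where
  open ℕ.≤-Reasoning
  arith₁ : ∀ g → 40 * (g * 4) ≡ 32 * (5 * g)
  arith₁ = solve-∀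
  arith₂ : ∀ t → 198 * t + 2 * t ≡ 40 * (5 * t)
  arith₂ = solve-∀
  bound : ∀ d → Σ[ e ∈ ℕ ] 15 + e ≡ d → fromℕ (f d) ℚ.< + 5 ℚ./ 4 ℚ.* fromℕ (2 ^ d)
  bound d (e , refl) = fromℕ-< (f d) (2 ^ d) (ℕ.*-cancelˡ-< 40 (f d * 4) (5 * 2 ^ d) (begin-strict
    40 * (f d * 4)          ≡⟨ arith₁ (f d) ⟩
    32 * (5 * f d)          ≤⟨ f-excess 5 e ⟩
    198 * 2 ^ d             <⟨ ℕ.m<m+n (198 * 2 ^ d) (ℕ.*-mono-≤ {1} {2} (s≤s z≤n) (ℕ.m^n>0 2 d)) ⟩
    198 * 2 ^ d + 2 * 2 ^ d ≡⟨ arith₂ (2 ^ d) ⟩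
    40 * (5 * 2 ^ d)        ∎))

mainTheorem8 :
    -- small values, and their agreement with the closed form
    (f 2 ≡ 6 × f 3 ≡ 11 × f 4 ≤ 21 × f 5 ≤ 41) ×
    (6 ≡ closedForm 2 × 11 ≡ closedForm 3 × 21 ≡ closedForm 4 × 41 ≡ closedForm 5) ×
    -- lifting inequality
    (∀ (r : ℕ) → f (r + 3) ≤ 6 * 2 ^ r + 3 * f r) ×
    -- failure of the closed form at d = 7, and from there on
    (f 7 ≤ 6 * 2 ^ 4 + 3 * 21 × 6 * 2 ^ 4 + 3 * 21 ≡ 159 × 159 < 161 × 161 ≡ closedForm 7) ×
    (∀ (d : ℕ) → 7 ≤ d → f d < closedForm d) ×
    -- f(d) ≤ (6/5 + o(1)) 2^d, which eventually beats (5/4) 2^d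
    (∀ (ε : ℚ) → 0ℚ ℚ.< ε → Σ[ N ∈ ℕ ] (∀ (d : ℕ) → N ≤ d →
      fromℕ (f d) ℚ.≤ (+ 6 ℚ./ 5 ℚ.+ ε) ℚ.* fromℕ (2 ^ d))) ×
    (+ 6 ℚ./ 5 ℚ.< + 5 ℚ./ 4) ×
    (Σ[ N ∈ ℕ ] (∀ (d : ℕ) → N ≤ d → fromℕ (f d) ℚ.< + 5 ℚ./ 4 ℚ.* fromℕ (2 ^ d))) ×
    -- for 2 ≤ d ≤ 6 the closed form is attained as an upper bound, and the
    -- lifting inequality yields nothing smaller
    (∀ (d : ℕ) → 2 ≤ d → d ≤ 6 → f d ≤ closedForm d) ×
    (∀ (r : ℕ) → r + 3 ≤ 6 → closedForm (r + 3) ≤ 6 * 2 ^ r + 3 * f r)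
mainTheorem8 =
  (ℕ.≤-antisym (f≤ cover₂) (size₂ (f-cover 2)) ,
   ℕ.≤-antisym (f≤ cover₃) (size₃ (f-cover 3)) ,
   f₄≤21 , f₅≤41) ,
  (refl , refl , refl , refl) ,
  leapfrog-f ,
  (ℕ.≤-trans (f-step 4) (ℕ.+-monoʳ-≤ 96 (ℕ.*-monoʳ-≤ 3 f₄≤21)) , refl , ℕ.m≤m+n 160 1 , refl) ,
  (λ d 7≤d → below d (ℕ.m≤n⇒∃[o]m+o≡n 7≤d)) ,
  f-≤-6/5+ε ,
  toWitness {a? = + 6 ℚ./ 5 ℚ.<? + 5 ℚ./ 4} tt ,
  f-<-5/4 ,
  attained ,
  no-gain
  where
  below : ∀ d → Σ[ e ∈ ℕ ] 7 + e ≡ d → f d < closedForm d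
  below d (e , refl) = ℕ.≤-trans (s≤s (f-from-7 e)) (ℕ.≤-reflexive (ℕ.+-comm 1 _))

  attained : ∀ d → 2 ≤ d → d ≤ 6 → f d ≤ closedForm d
  attained 2 _ _ = f≤ cover₂
  attained 3 _ _ = f≤ cover₃
  attained 4 _ _ = f₄≤21
  attained 5 _ _ = f₅≤41
  attained 6 _ _ = f₆≤81
  attained 1 (s≤s ()) _
  attained (suc (suc (suc (suc (suc (suc (suc _)))))))
    _ (s≤s (s≤s (s≤s (s≤s (s≤s (s≤s ()))))))

  -- Lower bounds on `f r` show that the lift gives at best 12, 21, 42, 81 for d = 3, 4, 5, 6,
  -- against the closed form 11, 21, 41, 81.
  no-gain : ∀ r → r + 3 ≤ 6 → closedForm (r + 3) ≤ 6 * 2 ^ r + 3 * f r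
  no-gain 0 _ = ℕ.≤-trans (ℕ.n≤1+n 11) (ℕ.+-monoʳ-≤ 6 (ℕ.*-monoʳ-≤ 3 (size₀ (f-cover 0))))
  no-gain 1 _ = ℕ.+-monoʳ-≤ 12 (ℕ.*-monoʳ-≤ 3 (size₁ (f-cover 1)))
  no-gain 2 _ = ℕ.≤-trans (ℕ.n≤1+n 41) (ℕ.+-monoʳ-≤ 24 (ℕ.*-monoʳ-≤ 3 (size₂ (f-cover 2))))
  no-gain 3 _ = ℕ.+-monoʳ-≤ 48 (ℕ.*-monoʳ-≤ 3 (size₃ (f-cover 3)))
  no-gain (suc (suc (suc (suc r)))) (s≤s (s≤s (s≤s (s≤s h)))) =
    contradiction (ℕ.≤-trans (ℕ.m≤n+m 3 r) h) λ { (s≤s (s≤s ())) }
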